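{- None of the three logical omniscience principles for ignorance is valid in $\mathtt{HIW}$, $\mathtt{HIU}$ or $\mathtt{HDI}$. That is, for each operator $I\in\{I^{w},I^{u},I^{d}\}$, with formulas ranging over the corresponding language and $\models\phi$ meaning that $\phi$ is valid in all topic-sensitive models: (1) there are formulas $\phi,\psi$ such that $\models\phi\rightarrow\psi$ but $\not\models\neg I\phi\rightarrow\neg I\psi$; (2) there is a formula $\phi$ such that $\models\phi$ but $\not\models\neg I\phi$; (3) there are formulas $\phi,\psi$ such that $\models\phi\leftrightarrow\psi$ but $\not\models\neg I\phi\leftrightarrow\neg I\psi$.
   Context: Let $\mathtt{Prop}$ be a countably infinite set of propositional variables. The languages are: for $\mathtt{HIW}$, $\phi:=p\mid\neg\phi\mid\phi\wedge\phi\mid I^{w}\phi\mid\Box\phi$; for $\mathtt{HIU}$, the same with $I^{u}$ in place of $I^{w}$; for $\mathtt{HDI}$, $\phi:=p\mid\neg\phi\mid\phi\wedge\phi\mid I^{d}\phi\mid G\phi\mid\Box\phi$. $\vee,\rightarrow,\leftrightarrow$ are defined classically. $Var(\phi)$ is the set of variables occurring in $\phi$. A topic model is $\mathcal{T}=(T,\oplus,t,\mathfrak{K})$ with $T$ a non-empty set, $\oplus:T\times T\to T$ idempotent, commutative and associative, $\mathfrak{K}\in T$, and $t:\mathtt{Prop}\to T$. Extend $t$ to formulas by $t(\phi)=\oplus\{t(p):p\in Var(\phi)\}$, and put $a\sqsubseteq b$ iff $a\oplus b=b$. A topic-sensitive model is $\mathcal{M}=(W,R,v,\mathcal{T})$ with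 $W\neq\emptyset$, $R\subseteq W\times W$ arbitrary, $v:\mathtt{Prop}\to\mathcal{P}(W)$, and $\mathcal{T}$ a topic model. Truth: $\mathcal{M},w\models p$ iff $w\in v(p)$; $\neg,\wedge$ classical; $\mathcal{M},w\models\Box\phi$ iff $\mathcal{M},w'\models\phi$ for all $w'\in W$; and - $\mathcal{M},w\models I^{w}\phi$ iff $t(\phi)\not\sqsubseteq\mathfrak{K}$ or there exist $w',w''\in W$ with $Rww'$, $Rww''$, $\mathcal{M},w'\models\phi$ and $\mathcal{M},w''\models\neg\phi$; - $\mathcal{M},w\models I^{u}\phi$ iff $t(\phi)\not\sqsubseteq\mathfrak{K}$ or ($\mathcal{M},w\models\phi$ and there exists $w'\in W$ with $Rww'$ and $\mathcal{M},w'\models\neg\phi$); - $\mathcal{M},w\models I^{d}\phi$ iff $t(\phi)\sqsubseteq\mathfrak{K}$ and $\mathcal{M},w\models\phi$ and for all $w'\neq w$, if $Rww'$ then $\mathcal{M},w'\models\neg\phi$; - $\mathcal{M},w\models G\phi$ iff $t(\phi)\sqsubseteq\mathfrak{K}$. A formula is valid ($\models\phi$) if it is true at every world of every topic-sensitive model. -}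

module Defs where

open import Algebra.Structures using (IsCommutativeBand)
open import Data.List.NonEmpty using (List⁺; [_]; _⁺++⁺_; map; foldr₁)
open import Data.Nat using (ℕ)
open import Data.Product using (_×_; ∃; ∃₂)
open import Data.Sum using (_⊎_)
open import Level using (0ℓ)
open import Relation.Binary.Core using (Rel)
open import Relation.Binary.PropositionalEquality using (_≡_; _≢_)
open import Relation.Nullary using (¬_)
open import Relation.Unary using (Pred)

infixr 8 ¬̇_ □_ G_ Iʷ_ Iᵘ_ Iᵈ_ I_
infixr 7 _∧̇_
infixr 6 _∨̇_
infixr 5 _⇒_
infix  4 _⇔_
infix  3 ⊨_ ⊭_

Prop′ : Set
Prop′ = ℕ

data Language : Set where
  HIW HIU HDI : Language

data Formula : Language → Set where
  var  : ∀ {L} → Prop′ → Formula L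
  ¬̇_   : ∀ {L} → Formula L → Formula L
  _∧̇_  : ∀ {L} → Formula L → Formula L → Formula L
  □_   : ∀ {L} → Formula L → Formula L
  Iʷ_  : Formula HIW → Formula HIW
  Iᵘ_  : Formula HIU → Formula HIU
  Iᵈ_  : Formula HDI → Formula HDI
  G_   : Formula HDI → Formula HDI

I_ : ∀ {L} → Formula L → Formula L
I_ {HIW} φ = Iʷ φ
I_ {HIU} φ = Iᵘ φ
I_ {HDI} φ = Iᵈ φ

_∨̇_ _⇒_ _⇔_ : ∀ {L} → Formula L → Formula L → Formula L
φ ∨̇ ψ = ¬̇ (¬̇ φ ∧̇ ¬̇ ψ)
φ ⇒ ψ = ¬̇ (φ ∧̇ ¬̇ ψ)
φ ⇔ ψ = (φ ⇒ ψ) ∧̇ (ψ ⇒ φ)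

-- Every formula contains a variable, so its finite set of variables is
-- enumerated by a non-empty list, possibly with repetitions.
Var : ∀ {L} → Formula L → List⁺ Prop′
Var (var p) = [ p ]
Var (¬̇ φ)   = Var φ
Var (φ ∧̇ ψ) = Var φ ⁺++⁺ Var ψ
Var (□ φ)   = Var φ
Var (Iʷ φ)  = Var φ
Var (Iᵘ φ)  = Var φ
Var (Iᵈ φ)  = Var φ
Var (G φ)   = Var φ

-- T is non-empty because 𝔎 is one of its elements.
record TopicModel : Set₁ where
  infixl 6 _⊕_
  infix  4 _⊑_ _⋢_
  field
    T                 : Set
    _⊕_               : T → T → T
    isCommutativeBand : IsCommutativeBand _≡_ _⊕_
    t                 : Prop′ → T
    𝔎                 : T

  _⊑_ _⋢_ : T → T → Set
  a ⊑ b = a ⊕ b ≡ b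
  a ⋢ b = ¬ (a ⊑ b)

  -- Since ⊕ is associative, commutative and idempotent, the fusion depends
  -- only on the set of variables, not on the order or multiplicity in Var φ.
  topic : ∀ {L} → Formula L → T
  topic φ = foldr₁ _⊕_ (map t (Var φ))

record Model : Set₁ where
  field
    W          : Set
    inhabitant : W
    R          : Rel W 0ℓ
    v          : Prop′ → Pred W 0ℓ
    topicModel : TopicModel

  open TopicModel topicModel public

module Truth (M : Model) where
  open Model M

  infix 3 _⊩_

  _⊩_ : ∀ {L} → W → Formula L → Set
  w ⊩ var p  = v p w
  w ⊩ ¬̇ φ    = ¬ (w ⊩ φ)
  w ⊩ φ ∧̇ ψ  = (w ⊩ φ) × (w ⊩ ψ)
  w ⊩ □ φ    = ∀ w′ → w′ ⊩ φ
  w ⊩ Iʷ φ   = topic φ ⋢ 𝔎 ⊎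
               ∃₂ λ w′ w″ → R w w′ × R w w″ × (w′ ⊩ φ) × ¬ (w″ ⊩ φ)
  w ⊩ Iᵘ φ   = topic φ ⋢ 𝔎 ⊎
               (w ⊩ φ) × ∃ λ w′ → R w w′ × ¬ (w′ ⊩ φ)
  w ⊩ Iᵈ φ   = topic φ ⊑ 𝔎 × (w ⊩ φ) ×
               (∀ w′ → w′ ≢ w → R w w′ → ¬ (w′ ⊩ φ))
  w ⊩ G φ    = topic φ ⊑ 𝔎

⊨_ ⊭_ : ∀ {L} → Formula L → Set₁
⊨ φ = (M : Model) (w : Model.W M) → Truth._⊩_ M w φ
⊭ φ = ¬ (⊨ φ)

{-# OPTIONS --safe #-}
-- All tautologies are equivalent, but the topic component lets ignorance tell
-- them apart: in a one-world model with no accessible world, Iʷ and Iᵘ hold of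
-- a tautology exactly when its topic is not grasped, and Iᵈ exactly when it is.
-- Hence an ignored and a non-ignored tautology refute all three principles.
module Submission where

open import Defs
open import Data.Bool using (Bool; true; false; _∨_)
open import Data.Bool.Properties using (∨-isSemilattice)
open import Data.Empty using (⊥)
open import Data.Nat using (zero; suc)
open import Data.Product using (_×_; ∃-syntax; _,_; proj₁)
open import Data.Sum using (inj₁; inj₂)
open import Data.Unit using (⊤; tt)
open import Relation.Binary.PropositionalEquality using (refl)
open import Relation.Nullary using (¬_)

tautology : ∀ {L} → Prop′ → Formula L
tautology p = var p ⇒ var p

tautology-valid : ∀ {L} p → ⊨ tautology {L} p
tautology-valid p M w (h , ¬h) = ¬h h

⇒-valid : ∀ {L} {φ ψ : Formula L} → ⊨ ψ → ⊨ φ ⇒ ψ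
⇒-valid ⊨ψ M w (_ , ¬ψ) = ¬ψ (⊨ψ M w)

⇔-valid : ∀ {L} {φ ψ : Formula L} → ⊨ φ → ⊨ ψ → ⊨ φ ⇔ ψ
⇔-valid {φ = φ} {ψ} ⊨φ ⊨ψ M w =
  ⇒-valid {φ = φ} {ψ} ⊨ψ M w , ⇒-valid {φ = ψ} {φ} ⊨φ M w

OmniscienceFails : Language → Set₁
OmniscienceFails L =
    (∃[ φ ] ∃[ ψ ] ((⊨ φ ⇒ ψ) × (⊭ (¬̇ I_ {L} φ) ⇒ (¬̇ I_ {L} ψ))))
    × (∃[ φ ] ((⊨ φ) × (⊭ ¬̇ I_ {L} φ)))
    × (∃[ φ ] ∃[ ψ ] ((⊨ φ ⇔ ψ) × (⊭ (¬̇ I_ {L} φ) ⇔ (¬̇ I_ {L} ψ))))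

module _ (M : Model) (w : Model.W M) where
  open Truth M

  -- One world separating `I φ` from `I ψ` suffices: implications between valid formulas are valid,
  -- while at `w` the formula `¬̇ I φ` is true and `¬̇ I ψ` false. The pair serves (1) and (3); `ψ`
  -- alone serves (2).
  omniscience-fails : ∀ {L} {φ ψ : Formula L} → ⊨ φ → ⊨ ψ →
    ¬ (w ⊩ I φ) → w ⊩ I ψ → OmniscienceFails L
  omniscience-fails {φ = φ} {ψ} ⊨φ ⊨ψ ¬Iφ Iψ =
      (φ , ψ , ⇒-valid {φ = φ} {ψ} ⊨ψ , λ valid → refute (valid M w))
    , (ψ , ⊨ψ , λ valid → valid M w Iψ)
    , (φ , ψ , ⇔-valid {φ = φ} {ψ} ⊨φ ⊨ψ , λ valid → refute (proj₁ (valid M w)))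
    where
    refute : ¬ (w ⊩ (¬̇ I φ) ⇒ (¬̇ I ψ))
    refute h = h (¬Iφ , λ ¬Iψ → ¬Iψ Iψ)

isolatedWorld : Model
isolatedWorld = record
  { W          = ⊤
  ; inhabitant = tt
  ; R          = λ _ _ → ⊥
  ; v          = λ _ _ → ⊤
  ; topicModel = record
    { T                 = Bool
    ; _⊕_               = _∨_
    ; isCommutativeBand = ∨-isSemilattice
    -- Under `_∨_`, `a ⊑ false` forces `a` to be `false`, so exactly the formulas whose only
    -- variable is 0 have a grasped topic.
    ; t                 = λ { zero → false ; (suc _) → true }
    ; 𝔎                 = false
    }
  }

proposition5 : (L : Language) →
    (∃[ φ ] ∃[ ψ ] ((⊨ φ ⇒ ψ) × (⊭ (¬̇ I_ {L} φ) ⇒ (¬̇ I_ {L} ψ))))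
    × (∃[ φ ] ((⊨ φ) × (⊭ ¬̇ I_ {L} φ)))
    × (∃[ φ ] ∃[ ψ ] ((⊨ φ ⇔ ψ) × (⊭ (¬̇ I_ {L} φ) ⇔ (¬̇ I_ {L} ψ))))
proposition5 HIW =
  omniscience-fails isolatedWorld tt {φ = tautology 0} {tautology 1}
    (tautology-valid {HIW} 0) (tautology-valid {HIW} 1)
    -- The topic of `tautology 0` computes to `false`, which refutes `off-topic`; the other disjunct
    -- would need a successor of `tt`.
    (λ { (inj₁ off-topic) → off-topic refl ; (inj₂ (_ , _ , () , _)) })
    (inj₁ λ ())
proposition5 HIU =
  omniscience-fails isolatedWorld tt {φ = tautology 0} {tautology 1}
    (tautology-valid {HIU} 0) (tautology-valid {HIU} 1)
    (λ { (inj₁ off-topic) → off-topic refl ; (inj₂ (_ , _ , () , _)) })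
    (inj₁ λ ())
proposition5 HDI =
  -- The two tautologies swap roles: `Iᵈ` requires a grasped topic, whereas an ungrasped one makes
  -- `Iʷ` and `Iᵘ` true.
  omniscience-fails isolatedWorld tt {φ = tautology 1} {tautology 0}
    (tautology-valid {HDI} 1) (tautology-valid {HDI} 0)
    (λ { (() , _) })
    (refl , tautology-valid {HDI} 0 isolatedWorld tt , λ _ _ ())
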